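{- Let $\Gamma,\Delta$ be finite multisets of formulas and $\varphi$ a formula. Then: (i) if $\Gamma\Rightarrow\Delta$ is provable in $\mathsf{G4KM}$, then $\Gamma\vdash_{\mathsf{KMH}}\bigvee\Delta$; and (ii) if $\Gamma\vdash_{\mathsf{KMH}}\varphi$, then $\Gamma\Rightarrow\varphi$ is provable in $\mathsf{G4KM}$.
   Context: Let $\mathsf{Prop}$ be a countably infinite set of propositional variables with decidable equality. Formulas: $\varphi ::= p\in\mathsf{Prop}\mid\bot\mid\varphi\land\varphi\mid\varphi\lor\varphi\mid\varphi\to\varphi\mid\Box\varphi$. $\Gamma,\Delta,\dots$ denote finite multisets of formulas; $\Gamma,\Delta$ denotes multiset sum, and a formula is identified with the singleton multiset. $\bigvee\Delta$ is the disjunction of all elements of $\Delta$ (with $\bigvee\emptyset=\bot$). $\Box^{ -1}\Gamma$ is the multiset obtained from $\Gamma$ by replacing each boxed formula $\Box\gamma$ by $\gamma$ (removing one outermost box) and keeping all formulas whose main connective is not $\Box$. Hilbert calculus. $\mathsf{KMH}$ derives consecutions $\Gamma\vdash\varphi$ ($\Gamma$ a set of formulas; a multiset is read as its underlying set). Axioms: all instances of the axiom schemes of a standard Hilbert system for intuitionistic propositional logic, together with all instances of (K) $\Box(\varphi\to\psi)\to(\Box\varphi\to\Box\psi)$; (SL) $(\Box\varphi\to\varphi)\to\varphi$; (KM) $\Box\varphi\to(\psi\lor(\psi\to\varphi))$. Rules: (Ax) $\Gamma\vdash\varphi$ if $\varphi$ is an instance of an axiom; (El) $\Gamma\vdash\varphi$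 if $\varphi\in\Gamma$; (MP) from $\Gamma\vdash\varphi$ and $\Gamma\vdash\varphi\to\psi$ infer $\Gamma\vdash\psi$; (Nec) from $\Gamma\vdash\varphi$ infer $\Gamma\vdash\Box\varphi$. Write $\Gamma\vdash_{\mathsf{KMH}}\varphi$ if $\Gamma\vdash\varphi$ is provable in $\mathsf{KMH}$. Sequent calculus. A sequent is an expression $\Gamma\Rightarrow\Delta$ with $\Gamma,\Delta$ finite multisets of formulas. The calculus $\mathsf{G4KM}$ has the following rules ($p$ a propositional variable; premises before "/", conclusion after): - ($\bot$L): / $\Gamma,\bot\Rightarrow\Delta$ - (IdP): / $\Gamma,p\Rightarrow p,\Delta$ - ($\land$L): $\Gamma,\varphi,\psi\Rightarrow\Delta$ / $\Gamma,\varphi\land\psi\Rightarrow\Delta$ - ($\land$R): $\Gamma\Rightarrow\varphi,\Delta$ and $\Gamma\Rightarrow\psi,\Delta$ / $\Gamma\Rightarrow\varphi\land\psi,\Delta$ - ($\lor$L): $\Gamma,\varphi\Rightarrow\Delta$ and $\Gamma,\psi\Rightarrow\Delta$ / $\Gamma,\varphi\lor\psi\Rightarrow\Delta$ - ($\lor$R): $\Gamma\Rightarrow\varphi,\psi,\Delta$ / $\Gamma\Rightarrow\varphi\lor\psi,\Delta$ - ($\land\!\to$L): $\Gamma,\varphi\to(\psi\to\chi)\Rightarrow\Delta$ / $\Gamma,(\varphi\land\psi)\to\chi\Rightarrow\Delta$ - ($\lor\!\to$L): $\Gamma,\varphi\to\chi,\psi\to\chi\Rightarrow\Delta$ / $\Gamma,(\varphi\lor\psi)\to\chi\Rightarrow\Delta$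 - ($p\!\to$L): $\Gamma,p,\varphi\Rightarrow\Delta$ / $\Gamma,p,p\to\varphi\Rightarrow\Delta$ - ($\Box$R): $\Box^{ -1}\Gamma,\Box\varphi\Rightarrow\varphi$ / $\Gamma\Rightarrow\Box\varphi,\Delta$ - ($\Box\!\to$L): $\Box^{ -1}\Gamma,\Box\varphi,\psi\Rightarrow\varphi$ and $\Gamma,\psi\Rightarrow\Delta$ / $\Gamma,\Box\varphi\to\psi\Rightarrow\Delta$ - ($\to$R): $\Gamma,\varphi\Rightarrow\psi,\Delta$ and $\Box^{ -1}\Gamma,\varphi\Rightarrow\psi$ / $\Gamma\Rightarrow\varphi\to\psi,\Delta$ - ($\to\!\to$L): $\Gamma,\chi\to\psi,\varphi\Rightarrow\Delta,\chi$ and $\Box^{ -1}\Gamma,\chi\to\psi,\varphi\Rightarrow\chi$ and $\Gamma,\psi\Rightarrow\Delta$ / $\Gamma,(\varphi\to\chi)\to\psi\Rightarrow\Delta$ A sequent is provable if it is the root of a finite derivation tree built from these rules. -}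

module Defs where

open import Data.List using (List; []; _∷_; map)
open import Data.List.Relation.Binary.Permutation.Propositional using (_↭_)
open import Level using (0ℓ)
open import Relation.Unary using (Pred)

infixr 9 □_
infixr 8 _∧_
infixr 7 _∨_
infixr 6 _⊃_

data Formula (Var : Set) : Set where
  var         : Var → Formula Var
  ⊥           : Formula Var
  _∧_ _∨_ _⊃_ : Formula Var → Formula Var → Formula Var
  □_          : Formula Var → Formula Var

private
  variable
    Var         : Set
    p           : Var
    φ ψ χ       : Formula Var
    Γ Γ′ Δ Δ′   : List (Formula Var)

-- Finite multisets of formulas are represented by lists; the rule `exchange`
-- of G4KM below makes provability invariant under permutation.

⋁ : List (Formula Var) → Formula Var
⋁ []          = ⊥
⋁ (φ ∷ [])    = φ
⋁ (φ ∷ ψ ∷ Δ) = φ ∨ ⋁ (ψ ∷ Δ)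

unbox : Formula Var → Formula Var
unbox (□ φ) = φ
unbox φ     = φ

□⁻¹ : List (Formula Var) → List (Formula Var)
□⁻¹ = map unbox

data Axiom {Var : Set} : Formula Var → Set where
  ⊃-const : Axiom (φ ⊃ ψ ⊃ φ)
  ⊃-dist  : Axiom ((φ ⊃ ψ ⊃ χ) ⊃ (φ ⊃ ψ) ⊃ φ ⊃ χ)
  ∧-elim₁ : Axiom (φ ∧ ψ ⊃ φ)
  ∧-elim₂ : Axiom (φ ∧ ψ ⊃ ψ)
  ∧-intro : Axiom (φ ⊃ ψ ⊃ φ ∧ ψ)
  ∨-intro₁ : Axiom (φ ⊃ φ ∨ ψ)
  ∨-intro₂ : Axiom (ψ ⊃ φ ∨ ψ)
  ∨-elim  : Axiom ((φ ⊃ χ) ⊃ (ψ ⊃ χ) ⊃ φ ∨ ψ ⊃ χ)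
  ⊥-elim  : Axiom (⊥ ⊃ φ)
  K       : Axiom (□ (φ ⊃ ψ) ⊃ □ φ ⊃ □ ψ)
  SL      : Axiom ((□ φ ⊃ φ) ⊃ φ)
  KM      : Axiom (□ φ ⊃ ψ ∨ (ψ ⊃ φ))

infix 3 _⊢KMH_

-- The context is an arbitrary, possibly infinite, set of formulas.
data _⊢KMH_ {Var : Set} (Γ : Pred (Formula Var) 0ℓ) : Formula Var → Set where
  Ax  : Axiom φ → Γ ⊢KMH φ
  El  : Γ φ → Γ ⊢KMH φ
  MP  : Γ ⊢KMH φ → Γ ⊢KMH φ ⊃ ψ → Γ ⊢KMH ψ
  Nec : Γ ⊢KMH φ → Γ ⊢KMH □ φ

infix 4 _⇒_

data Sequent (Var : Set) : Set where
  _⇒_ : List (Formula Var) → List (Formula Var) → Sequent Var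

data G4KM {Var : Set} : Sequent Var → Set where
  -- The identity on multisets, visible only because they are represented
  -- by lists.
  exchange : Γ ↭ Γ′ → Δ ↭ Δ′ → G4KM (Γ ⇒ Δ) → G4KM (Γ′ ⇒ Δ′)

  ⊥L  : G4KM (⊥ ∷ Γ ⇒ Δ)
  IdP : G4KM (var p ∷ Γ ⇒ var p ∷ Δ)
  ∧L  : G4KM (φ ∷ ψ ∷ Γ ⇒ Δ) → G4KM (φ ∧ ψ ∷ Γ ⇒ Δ)
  ∧R  : G4KM (Γ ⇒ φ ∷ Δ) → G4KM (Γ ⇒ ψ ∷ Δ) → G4KM (Γ ⇒ φ ∧ ψ ∷ Δ)
  ∨L  : G4KM (φ ∷ Γ ⇒ Δ) → G4KM (ψ ∷ Γ ⇒ Δ) → G4KM (φ ∨ ψ ∷ Γ ⇒ Δ)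
  ∨R  : G4KM (Γ ⇒ φ ∷ ψ ∷ Δ) → G4KM (Γ ⇒ φ ∨ ψ ∷ Δ)
  ∧⊃L : G4KM (φ ⊃ (ψ ⊃ χ) ∷ Γ ⇒ Δ) → G4KM ((φ ∧ ψ) ⊃ χ ∷ Γ ⇒ Δ)
  ∨⊃L : G4KM (φ ⊃ χ ∷ ψ ⊃ χ ∷ Γ ⇒ Δ) → G4KM ((φ ∨ ψ) ⊃ χ ∷ Γ ⇒ Δ)
  p⊃L : G4KM (var p ∷ φ ∷ Γ ⇒ Δ) → G4KM (var p ∷ var p ⊃ φ ∷ Γ ⇒ Δ)
  □R  : G4KM (□ φ ∷ □⁻¹ Γ ⇒ φ ∷ []) → G4KM (Γ ⇒ □ φ ∷ Δ)
  □⊃L : G4KM (□ φ ∷ ψ ∷ □⁻¹ Γ ⇒ φ ∷ []) →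
        G4KM (ψ ∷ Γ ⇒ Δ) →
        G4KM (□ φ ⊃ ψ ∷ Γ ⇒ Δ)
  ⊃R  : G4KM (φ ∷ Γ ⇒ ψ ∷ Δ) →
        G4KM (φ ∷ □⁻¹ Γ ⇒ ψ ∷ []) →
        G4KM (Γ ⇒ φ ⊃ ψ ∷ Δ)
  ⊃⊃L : G4KM (χ ⊃ ψ ∷ φ ∷ Γ ⇒ χ ∷ Δ) →
        G4KM (χ ⊃ ψ ∷ φ ∷ □⁻¹ Γ ⇒ χ ∷ []) →
        G4KM (ψ ∷ Γ ⇒ Δ) →
        G4KM ((φ ⊃ χ) ⊃ ψ ∷ Γ ⇒ Δ)

{-# OPTIONS --safe #-}
module Submission where

-- Soundness is by induction on derivations; strong Löb yields φ ⊃ □ φ, hence a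
-- deduction theorem for KMH, and KM justifies the splitting of implications into
-- a premise about the current world and one about the strictly later worlds.
--
-- Completeness is semantic. KMH is sound for finite trees in which □ quantifies
-- over the proper descendants. Backward proof search in G4KM terminates and
-- either finds a derivation or a countermodel: once no rule about the current
-- world helps, the refuted premises about later worlds provide the children of
-- a new root, labelled by the antecedent.

open import Data.Empty renaming (⊥ to Empty) using ()
open import Data.List using (List; []; _∷_; _++_; map)
open import Data.List.Membership.Propositional using (_∈_)
open import Data.List.Membership.Propositional.Properties using (∈-map⁺; ∈-map⁻; ∈-∃++)
open import Data.List.Properties using (map-++)
open import Data.List.Relation.Binary.Permutation.Propositional using (_↭_; ↭-sym; ↭-refl; ↭-trans; prep; swap)
open import Data.List.Relation.Binary.Permutation.Propositional.Properties using (∈-resp-↭; All-resp-↭; map⁺; shift)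
open import Data.List.Relation.Binary.Subset.Propositional using (_⊆_)
open import Data.List.Relation.Binary.Subset.Propositional.Properties using (xs⊆xs++ys; xs⊆ys++xs)
open import Data.List.Relation.Unary.All as All using (All; []; _∷_)
open import Data.List.Relation.Unary.All.Properties using (++⁺)
open import Data.List.Relation.Unary.Any using (here; there; any?)
open import Data.Nat using (ℕ; suc; _+_; _*_; _≤_; _<_; z≤n)
open import Data.Nat.Induction using (<-wellFounded)
open import Data.Nat.ListAction using (sum)
open import Data.Nat.ListAction.Properties using (sum-↭; sum-++)
open import Data.Nat.Properties using (≤-refl; ≤-reflexive; ≤-trans; ≤-<-trans; m≤m+n; m≤n+m; m≤n⇒m≤1+n; +-assoc; +-mono-≤; +-mono-<-≤; +-monoˡ-≤; +-monoʳ-≤)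
open import Data.Nat.Tactic.RingSolver using (solve-∀)
open import Data.Product using (_×_; _,_; ∃-syntax; proj₁; proj₂)
open import Data.Sum as Sum using (_⊎_; inj₁; inj₂)
open import Function.Base using (_∘_; id; case_of_)
open import Function.Bundles using (_↔_)
open import Induction.WellFounded using (Acc; acc)
open import Relation.Binary.Construct.Closure.ReflexiveTransitive using (Star; ε; _◅_; _◅◅_)
open import Relation.Binary.Definitions using (DecidableEquality)
open import Relation.Binary.PropositionalEquality
open import Relation.Nullary.Decidable using (Dec; yes; no; map′)
open import Relation.Nullary.Negation using (¬_; Stable; contradiction)
open import Defs

private
  variable
    Var       : Set
    Γ Γ′ Δ Δ′ : List (Formula Var)
    φ ψ χ     : Formula Var

-- Derived rules of the Hilbert calculus.

infix 3 _⊢_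

_⊢_ : List (Formula Var) → Formula Var → Set
Γ ⊢ φ = (_∈ Γ) ⊢KMH φ

infixl 9 _·_

_·_ : Γ ⊢ φ ⊃ ψ → Γ ⊢ φ → Γ ⊢ ψ
d · e = MP e d

⊃-trans : Γ ⊢ φ ⊃ ψ → Γ ⊢ ψ ⊃ χ → Γ ⊢ φ ⊃ χ
⊃-trans d e = Ax ⊃-dist · (Ax ⊃-const · e) · d

⊃-refl : Γ ⊢ φ ⊃ φ
⊃-refl {φ = φ} = Ax ⊃-dist · Ax ⊃-const · Ax (⊃-const {ψ = φ})

□-map : Γ ⊢ φ ⊃ ψ → Γ ⊢ □ φ ⊃ □ ψ
□-map d = Ax K · Nec d

-- SL applied to φ ∧ □ φ, since □ (φ ∧ □ φ) implies □ φ.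
□-unit : Γ ⊢ φ ⊃ □ φ
□-unit = ⊃-trans (⊃-trans step (Ax SL)) (Ax ∧-elim₂)
  where
  step : Γ ⊢ φ ⊃ □ (φ ∧ □ φ) ⊃ φ ∧ □ φ
  step = Ax ⊃-dist
       · ⊃-trans (⊃-trans (Ax ∧-intro) (Ax ⊃-const)) (Ax ⊃-dist)
       · (Ax ⊃-const · □-map (Ax ∧-elim₁))

deduction : φ ∷ Γ ⊢ ψ → Γ ⊢ φ ⊃ ψ
deduction (Ax a)            = Ax ⊃-const · Ax a
deduction (El (here refl))  = ⊃-refl
deduction (El (there φ∈Γ))  = Ax ⊃-const · El φ∈Γ
deduction (MP d e)          = Ax ⊃-dist · deduction e · deduction d
-- Necessitation also applies under hypotheses, so the implication obtained by recursion has to be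
-- prolonged by `□-unit`.
deduction (Nec d)           = ⊃-trans (deduction d) □-unit

cut : All (Γ′ ⊢_) Γ → Γ ⊢ φ → Γ′ ⊢ φ
cut ds (Ax a)   = Ax a
cut ds (El φ∈Γ) = All.lookup ds φ∈Γ
cut ds (MP d e) = MP (cut ds d) (cut ds e)
cut ds (Nec d)  = Nec (cut ds d)

hyps : Γ ⊆ Γ′ → All (Γ′ ⊢_) Γ
hyps Γ⊆Γ′ = All.tabulate (El ∘ Γ⊆Γ′)

hyp₀ : φ ∷ Γ ⊢ φ
hyp₀ = El (here refl)

hyp₁ : ψ ∷ φ ∷ Γ ⊢ φ
hyp₁ = El (there (here refl))

hyp₂ : χ ∷ ψ ∷ φ ∷ Γ ⊢ φ
hyp₂ = El (there (there (here refl)))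

wk : Γ ⊢ ψ → φ ∷ Γ ⊢ ψ
wk = cut (hyps there)

∨-case : Γ ⊢ φ ∨ ψ → φ ∷ Γ ⊢ χ → ψ ∷ Γ ⊢ χ → Γ ⊢ χ
∨-case d e f = Ax ∨-elim · deduction e · deduction f · d

-- Makes premises about later worlds usable at the current one. `K` distributes the box over modus
-- ponens, and a hypothesis that `□⁻¹` leaves unchanged gets its box from `□-unit`.
□⁻¹-□ : □⁻¹ Γ ⊢ φ → Γ ⊢ □ φ
□⁻¹-□ (Ax a)   = Nec (Ax a)
□⁻¹-□ (MP d e) = Ax K · □⁻¹-□ e · □⁻¹-□ d
□⁻¹-□ (Nec d)  = Nec (□⁻¹-□ d)
□⁻¹-□ (El φ∈)  with ∈-map⁻ unbox φ∈
... | □ γ     , γ∈Γ , refl = El γ∈Γ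
... | var p   , γ∈Γ , refl = □-unit · El γ∈Γ
... | ⊥       , γ∈Γ , refl = □-unit · El γ∈Γ
... | γ ∧ δ   , γ∈Γ , refl = □-unit · El γ∈Γ
... | γ ∨ δ   , γ∈Γ , refl = □-unit · El γ∈Γ
... | γ ⊃ δ   , γ∈Γ , refl = □-unit · El γ∈Γ

-- Discharges the diagonal formula `□ φ` that `□R` and `□⊃L` put on the left of their premises.
löb : □ φ ∷ Γ ⊢ φ → Γ ⊢ φ
löb d = Ax SL · deduction d

-- To prove φ ⊃ ψ or χ it suffices to prove ψ or χ from φ at the current
-- world, and ψ from φ at all strictly later worlds.
⊃-by-KM : φ ∷ □⁻¹ Γ ⊢ ψ → φ ∷ Γ ⊢ χ → (φ ⊃ ψ) ∷ Γ ⊢ χ → Γ ⊢ χ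
⊃-by-KM d e f = ∨-case (Ax KM · □⁻¹-□ (deduction d)) e
  (cut (deduction (hyp₁ · hyp₀ · hyp₀) ∷ hyps there) f)

-- Soundness of the sequent rules.

⋁-intro : φ ∈ Δ → Γ ⊢ φ → Γ ⊢ ⋁ Δ
⋁-intro {Δ = _ ∷ []}    (here refl) d = d
⋁-intro {Δ = _ ∷ _ ∷ _} (here refl) d = Ax ∨-intro₁ · d
⋁-intro {Δ = _ ∷ _ ∷ _} (there φ∈Δ) d = Ax ∨-intro₂ · ⋁-intro φ∈Δ d

⋁-elim : (∀ {φ} → φ ∈ Δ → φ ∷ Γ ⊢ χ) → Γ ⊢ ⋁ Δ → Γ ⊢ χ
⋁-elim {Δ = []}        h d = Ax ⊥-elim · d
⋁-elim {Δ = _ ∷ []}    h d = deduction (h (here refl)) · d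
⋁-elim {Δ = _ ∷ _ ∷ _} h d = ∨-case d (h (here refl))
  (⋁-elim (λ φ∈Δ → cut (hyp₀ ∷ hyps (there ∘ there)) (h (there φ∈Δ))) hyp₀)

⋁-head : ∀ Δ → Γ ⊢ φ → Γ ⊢ ⋁ (φ ∷ Δ)
⋁-head Δ = ⋁-intro {Δ = _ ∷ Δ} (here refl)

⋁-side : ∀ Δ → ψ ∈ Δ → ψ ∷ Γ ⊢ ⋁ (φ ∷ Δ)
⋁-side Δ ψ∈Δ = ⋁-intro {Δ = _ ∷ Δ} (there ψ∈Δ) hyp₀

⋁-case : ∀ Δ → Γ ⊢ ⋁ (φ ∷ Δ) → φ ∷ Γ ⊢ χ → (∀ {ψ} → ψ ∈ Δ → ψ ∷ Γ ⊢ χ) → Γ ⊢ χ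
⋁-case Δ d e f = ⋁-elim {Δ = _ ∷ Δ} (λ { (here refl) → e ; (there ψ∈Δ) → f ψ∈Δ }) d

⋁-replace : ∀ Δ → φ ∷ Γ ⊢ ψ → Γ ⊢ ⋁ (φ ∷ Δ) → Γ ⊢ ⋁ (ψ ∷ Δ)
⋁-replace Δ e d = ⋁-case Δ d (⋁-head Δ e) (⋁-side Δ)

G4KM-sound : G4KM (Γ ⇒ Δ) → Γ ⊢ ⋁ Δ
G4KM-sound (exchange {Δ = Δ} {Δ′ = Δ′} Γ↭ Δ↭ d) =
  ⋁-elim {Δ = Δ} (λ φ∈Δ → ⋁-intro {Δ = Δ′} (∈-resp-↭ Δ↭ φ∈Δ) hyp₀)
         (cut (hyps (∈-resp-↭ Γ↭)) (G4KM-sound d))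
G4KM-sound ⊥L  = Ax ⊥-elim · hyp₀
G4KM-sound (IdP {Δ = Δ}) = ⋁-head Δ hyp₀
G4KM-sound (∧L d) =
  cut (Ax ∧-elim₁ · hyp₀ ∷ Ax ∧-elim₂ · hyp₀ ∷ hyps there) (G4KM-sound d)
G4KM-sound (∧R {Δ = Δ} d e) =
  ⋁-case Δ (G4KM-sound d)
    (⋁-replace Δ (Ax ∧-intro · hyp₁ · hyp₀) (wk (G4KM-sound e)))
    (⋁-side Δ)
G4KM-sound (∨L d e) = ∨-case hyp₀
  (cut (hyp₀ ∷ hyps (there ∘ there)) (G4KM-sound d))
  (cut (hyp₀ ∷ hyps (there ∘ there)) (G4KM-sound e))
G4KM-sound (∨R {ψ = ψ} {Δ = Δ} d) =
  ⋁-case (ψ ∷ Δ) (G4KM-sound d) (⋁-head Δ (Ax ∨-intro₁ · hyp₀)) λ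
    { (here refl) → ⋁-head Δ (Ax ∨-intro₂ · hyp₀)
    ; (there φ∈Δ) → ⋁-side Δ φ∈Δ }
G4KM-sound (∧⊃L d) =
  cut (deduction (deduction (hyp₂ · (Ax ∧-intro · hyp₁ · hyp₀))) ∷ hyps there)
      (G4KM-sound d)
G4KM-sound (∨⊃L d) =
  cut (deduction (hyp₁ · (Ax ∨-intro₁ · hyp₀))
        ∷ deduction (hyp₁ · (Ax ∨-intro₂ · hyp₀)) ∷ hyps there)
      (G4KM-sound d)
G4KM-sound (p⊃L d) =
  cut (hyp₀ ∷ hyp₁ · hyp₀ ∷ hyps (there ∘ there)) (G4KM-sound d)
G4KM-sound (□R {Δ = Δ} d) = ⋁-head Δ (□⁻¹-□ (löb (G4KM-sound d)))
G4KM-sound (□⊃L {φ} {ψ} {Γ} d e) =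
  -- The principal implication has no outer box, so it survives among the later hypotheses, where
  -- together with `□ φ` it supplies `ψ`.
  cut (hyp₀ · □⁻¹-□ (löb boxed) ∷ hyps there) (G4KM-sound e)
  where
  boxed : □ φ ∷ □ φ ⊃ ψ ∷ □⁻¹ Γ ⊢ φ
  boxed = cut (hyp₀ ∷ hyp₁ · hyp₀ ∷ hyps (there ∘ there)) (G4KM-sound d)
G4KM-sound (⊃R {Δ = Δ} d e) =
  ⊃-by-KM (G4KM-sound e)
    (⋁-replace Δ (deduction hyp₁) (G4KM-sound d))
    (⋁-head Δ hyp₀)
G4KM-sound (⊃⊃L {χ} {ψ} {φ} {Γ} {Δ} d e f) =
  -- The split is on `φ ⊃ χ`, which yields `ψ` at once. In the other case `φ` holds, and if the
  -- first premise delivers `χ`, this gives `φ ⊃ χ` and again `ψ`.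
  ⊃-by-KM
    (cut premises (G4KM-sound e))
    (⋁-case Δ (cut premises (G4KM-sound d))
      (cut (hyp₂ · deduction hyp₁ ∷ hyps (there ∘ there ∘ there)) (G4KM-sound f))
      (λ φ∈Δ → ⋁-intro φ∈Δ hyp₀))
    (cut (hyp₁ · hyp₀ ∷ hyps (there ∘ there)) (G4KM-sound f))
  where
  premises : ∀ {Γ} → All (φ ∷ (φ ⊃ χ) ⊃ ψ ∷ Γ ⊢_) (χ ⊃ ψ ∷ φ ∷ Γ)
  premises = deduction (hyp₂ · deduction hyp₁) ∷ hyp₀ ∷ hyps (there ∘ there)

-- Finite Kripke models

-- Labels need not grow along the tree: forcing of var p requires var p in the
-- labels of all descendants.
data Tree (Var : Set) : Set where
  node : List (Formula Var) → List (Tree Var) → Tree Var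

label : Tree Var → List (Formula Var)
label (node Γ us) = Γ

children : Tree Var → List (Tree Var)
children (node Γ us) = us

private
  variable
    t u v : Tree Var

infix 4 _▷_ _≤ᵗ_ _<ᵗ_

_▷_ : Tree Var → Tree Var → Set
t ▷ u = u ∈ children t

_≤ᵗ_ : Tree Var → Tree Var → Set
_≤ᵗ_ = Star _▷_

_<ᵗ_ : Tree Var → Tree Var → Set
t <ᵗ u = ∃[ c ] t ▷ c × c ≤ᵗ u

≤ᵗ-<ᵗ-trans : t ≤ᵗ u → u <ᵗ v → t <ᵗ v
≤ᵗ-<ᵗ-trans ε         u<v             = u<v
≤ᵗ-<ᵗ-trans (t▷c ◅ s) (d , u▷d , d≤v) = _ , t▷c , s ◅◅ u▷d ◅ d≤v

<ᵗ⇒≤ᵗ : t <ᵗ u → t ≤ᵗ u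
<ᵗ⇒≤ᵗ (c , t▷c , c≤u) = t▷c ◅ c≤u

infix 3 _⊩_

-- The negative readings of variables and disjunction make forcing stable, so
-- that classical reasoning inside a model is available without deciding it.
_⊩_ : Tree Var → Formula Var → Set
t ⊩ var p = ∀ u → t ≤ᵗ u → ¬ ¬ (var p ∈ label u)
t ⊩ ⊥     = Empty
t ⊩ φ ∧ ψ = (t ⊩ φ) × (t ⊩ ψ)
t ⊩ φ ∨ ψ = ¬ (¬ (t ⊩ φ) × ¬ (t ⊩ ψ))
t ⊩ φ ⊃ ψ = ∀ u → t ≤ᵗ u → u ⊩ φ → u ⊩ ψ
t ⊩ □ φ   = ∀ u → t <ᵗ u → u ⊩ φ

⊩-stable : (φ : Formula Var) → Stable (t ⊩ φ)
⊩-stable (var p) h u t≤u n = h λ f → f u t≤u n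
⊩-stable ⊥       h         = h id
⊩-stable (φ ∧ ψ) h         =
  ⊩-stable φ (λ n → h (n ∘ proj₁)) , ⊩-stable ψ (λ n → h (n ∘ proj₂))
⊩-stable (φ ∨ ψ) h n       = h λ f → f n
⊩-stable (φ ⊃ ψ) h u t≤u d = ⊩-stable ψ λ n → h λ f → n (f u t≤u d)
⊩-stable (□ φ)   h u t<u   = ⊩-stable φ λ n → h λ f → n (f u t<u)

⊩-mono : (φ : Formula Var) → t ≤ᵗ u → t ⊩ φ → u ⊩ φ
⊩-mono (var p) t≤u h v u≤v = h v (t≤u ◅◅ u≤v)
⊩-mono (φ ∧ ψ) t≤u (h , k) = ⊩-mono φ t≤u h , ⊩-mono ψ t≤u k
⊩-mono (φ ∨ ψ) t≤u h (m , n) = h (m ∘ ⊩-mono φ t≤u , n ∘ ⊩-mono ψ t≤u)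
⊩-mono (φ ⊃ ψ) t≤u h v u≤v = h v (t≤u ◅◅ u≤v)
⊩-mono (□ φ)   t≤u h v u<v = h v (≤ᵗ-<ᵗ-trans t≤u u<v)

module _ (φ : Formula Var) where

  -- Induction on the tree, simultaneously for lists of children: once `φ` holds at all children,
  -- persistence spreads it to all proper descendants, so `□ φ` holds at the root.
  ⊩-löb  : ∀ t → t ⊩ □ φ ⊃ φ → t ⊩ φ
  ⊩-löb* : ∀ ts → All (_⊩ □ φ ⊃ φ) ts → All (_⊩ φ) ts

  ⊩-löb (node Γ us) h = h _ ε λ { u (c , c∈us , c≤u) →
    ⊩-mono φ c≤u (All.lookup (⊩-löb* us
      (All.tabulate λ v∈us → ⊩-mono (□ φ ⊃ φ) (v∈us ◅ ε) h)) c∈us) }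

  ⊩-löb* []       []       = []
  ⊩-löb* (t ∷ ts) (h ∷ hs) = ⊩-löb t h ∷ ⊩-löb* ts hs

Axiom-sound : Axiom φ → (t : Tree Var) → t ⊩ φ
Axiom-sound (⊃-const {φ = φ}) t u _ a v u≤v _ = ⊩-mono φ u≤v a
Axiom-sound ⊃-dist t u _ f v u≤v g w v≤w a =
  f w (u≤v ◅◅ v≤w) a w ε (g w v≤w a)
Axiom-sound ∧-elim₁ t u _ = proj₁
Axiom-sound ∧-elim₂ t u _ = proj₂
Axiom-sound (∧-intro {φ = φ}) t u _ a v u≤v b = ⊩-mono φ u≤v a , b
Axiom-sound ∨-intro₁ t u _ a n = proj₁ n a
Axiom-sound ∨-intro₂ t u _ b n = proj₂ n b
Axiom-sound (∨-elim {χ = χ}) t u _ f v u≤v g w v≤w d =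
  ⊩-stable χ λ n → d (n ∘ f w (u≤v ◅◅ v≤w) , n ∘ g w v≤w)
Axiom-sound ⊥-elim t u _ ()
Axiom-sound K t u _ f v u≤v g w v<w = f w (≤ᵗ-<ᵗ-trans u≤v v<w) w ε (g w v<w)
Axiom-sound (SL {φ = φ}) t u _ = ⊩-löb φ u
-- Given `□ φ`, only `u` itself could violate `ψ ⊃ φ`, and there `ψ` is refuted by `m`.
Axiom-sound KM t u _ b (m , n) = n λ
  { _ ε         a → contradiction a m
  ; v (u▷c ◅ s) _ → b v (_ , u▷c , s) }

KMH-sound : All (t ⊩_) Γ → Γ ⊢ φ → t ⊩ φ
KMH-sound         hs (Ax a)   = Axiom-sound a _
KMH-sound         hs (El φ∈Γ) = All.lookup hs φ∈Γ
KMH-sound {t = t} hs (MP d e) = KMH-sound hs e t ε (KMH-sound hs d)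
-- By persistence the hypotheses are still available at every descendant.
KMH-sound         hs (Nec d)  = λ u t<u →
  KMH-sound (All.map (λ {γ} → ⊩-mono γ (<ᵗ⇒≤ᵗ t<u)) hs) d

-- The termination measure

-- The factor `3 + size ψ` makes `φ ∧ ψ ⊃ χ` outweigh its curried form, the constant 3 for `∨` pays
-- for the duplicated `χ` in `∨⊃L`, and `□ φ` pays for the two copies of `φ` in the premise of `□R`.
size : Formula Var → ℕ
size (var p) = 0
size ⊥       = 0
size (φ ∧ ψ) = (2 + size φ) * (3 + size ψ)
size (φ ∨ ψ) = 3 + (size φ + size ψ)
size (φ ⊃ ψ) = (2 + size φ) * (2 + size ψ)
size (□ φ)   = 1 + (size φ + size φ)

total : List (Formula Var) → ℕ
total = sum ∘ map size

-- An outermost box on the left can only be removed, so it is not counted; this makes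
-- the premise □ φ, □⁻¹ Γ ⇒ φ of □R smaller than its conclusion.
measure : List (Formula Var) → List (Formula Var) → ℕ
measure Γ Δ = total (□⁻¹ Γ) + total Δ

total-↭ : Γ ↭ Γ′ → total Γ ≡ total Γ′
total-↭ = sum-↭ ∘ map⁺ size

size-unbox : (φ : Formula Var) → size (unbox φ) ≤ size φ
size-unbox (var p) = ≤-refl
size-unbox ⊥       = ≤-refl
size-unbox (φ ∧ ψ) = ≤-refl
size-unbox (φ ∨ ψ) = ≤-refl
size-unbox (φ ⊃ ψ) = ≤-refl
size-unbox (□ φ)   = m≤n⇒m≤1+n (m≤m+n _ _)

total-□⁻¹ : (Γ : List (Formula Var)) → total (□⁻¹ Γ) ≤ total Γ
total-□⁻¹ []      = ≤-refl
total-□⁻¹ (φ ∷ Γ) = +-mono-≤ (size-unbox φ) (total-□⁻¹ Γ)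

total-++ : (Γ Γ′ : List (Formula Var)) → total (Γ ++ Γ′) ≡ total Γ + total Γ′
total-++ Γ Γ′ =
  trans (cong sum (map-++ size Γ Γ′)) (sum-++ (map size Γ) (map size Γ′))

measure-++ : ∀ (Γ Γ′ Δ Δ′ : List (Formula Var)) →
  measure (Γ ++ Γ′) (Δ ++ Δ′) ≡ measure Γ Δ + measure Γ′ Δ′
measure-++ Γ Γ′ Δ Δ′ = begin
  total (□⁻¹ (Γ ++ Γ′)) + total (Δ ++ Δ′)
    ≡⟨ cong (λ Θ → total Θ + total (Δ ++ Δ′)) (map-++ unbox Γ Γ′) ⟩
  total (□⁻¹ Γ ++ □⁻¹ Γ′) + total (Δ ++ Δ′)
    ≡⟨ cong₂ _+_ (total-++ (□⁻¹ Γ) (□⁻¹ Γ′)) (total-++ Δ Δ′) ⟩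
  (total (□⁻¹ Γ) + total (□⁻¹ Γ′)) + (total Δ + total Δ′)
    ≡⟨ interchange (total (□⁻¹ Γ)) _ _ _ ⟩
  measure Γ Δ + measure Γ′ Δ′ ∎
  where
  open ≡-Reasoning
  interchange : ∀ m n o p → (m + n) + (o + p) ≡ (m + o) + (n + p)
  interchange = solve-∀

-- Naming the slack `d` turns the size bounds below into polynomial identities for the ring solver.
<-by : ∀ {m n} d → suc m + d ≡ n → m < n
<-by d refl = m≤m+n _ d

size-∧ : (φ ψ : Formula Var) → total (φ ∷ ψ ∷ []) < size (φ ∧ ψ)
size-∧ φ ψ = <-by _ (eq (size φ) (size ψ))
  where
  eq : ∀ a b → suc (a + (b + 0)) + (5 + 2 * a + b + a * b) ≡ (2 + a) * (3 + b)
  eq = solve-∀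

size-∨ : (φ ψ : Formula Var) → total (φ ∷ ψ ∷ []) < size (φ ∨ ψ)
size-∨ φ ψ = <-by _ (eq (size φ) (size ψ))
  where
  eq : ∀ a b → suc (a + (b + 0)) + 2 ≡ 3 + (a + b)
  eq = solve-∀

size-⊃ : (φ ψ : Formula Var) → total (φ ∷ ψ ∷ []) < size (φ ⊃ ψ)
size-⊃ φ ψ = <-by _ (eq (size φ) (size ψ))
  where
  eq : ∀ a b → suc (a + (b + 0)) + (3 + a + b + a * b) ≡ (2 + a) * (2 + b)
  eq = solve-∀

size-□ : (φ : Formula Var) → total (φ ∷ φ ∷ []) < size (□ φ)
size-□ φ = <-by _ (eq (size φ))
  where
  eq : ∀ a → suc (a + (a + 0)) + 0 ≡ 1 + (a + a)
  eq = solve-∀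

size-∧⊃ : (φ ψ χ : Formula Var) → total (φ ⊃ ψ ⊃ χ ∷ []) < size (φ ∧ ψ ⊃ χ)
size-∧⊃ φ ψ χ = <-by _ (eq (size φ) (size ψ) (size χ))
  where
  eq : ∀ a b c →
    suc ((2 + a) * (2 + (2 + b) * (2 + c)) + 0) + (3 + 4 * c + a * c)
    ≡ (2 + (2 + a) * (3 + b)) * (2 + c)
  eq = solve-∀

size-∨⊃ : (φ ψ χ : Formula Var) → total (φ ⊃ χ ∷ ψ ⊃ χ ∷ []) < size (φ ∨ ψ ⊃ χ)
size-∨⊃ φ ψ χ = <-by _ (eq (size φ) (size ψ) (size χ))
  where
  eq : ∀ a b c →
    suc ((2 + a) * (2 + c) + ((2 + b) * (2 + c) + 0)) + (1 + c)
    ≡ (2 + (3 + (a + b))) * (2 + c)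
  eq = solve-∀

-- For the later premise of `□⊃L`: `φ` is listed twice because `□ φ` on the left weighs only as much
-- as `φ`.
size-□⊃ : (φ ψ : Formula Var) → total (φ ∷ ψ ∷ φ ∷ []) < size (□ φ ⊃ ψ)
size-□⊃ φ ψ = <-by _ (eq (size φ) (size ψ))
  where
  eq : ∀ a b →
    suc (a + (b + (a + 0))) + (5 + 2 * b + 2 * a + 2 * a * b)
    ≡ (2 + (1 + (a + a))) * (2 + b)
  eq = solve-∀

size-⊃⊃ : (φ χ ψ : Formula Var) →
  total (χ ⊃ ψ ∷ φ ∷ χ ∷ []) < size ((φ ⊃ χ) ⊃ ψ)
size-⊃⊃ φ χ ψ = <-by _ (eq (size φ) (size χ) (size ψ))
  where
  eq : ∀ a c b →
    suc ((2 + c) * (2 + b) + (a + (c + 0)))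
      + (a * b * c + 2 * a * c + 2 * a * b + 3 * a + b * c + c + 4 * b + 7)
    ≡ (2 + (2 + a) * (2 + c)) * (2 + b)
  eq = solve-∀

total-<₁ : ∀ {n} (φ ψ : Formula Var) → total (φ ∷ ψ ∷ []) < n → total (φ ∷ []) < n
total-<₁ φ ψ = ≤-<-trans (+-monoʳ-≤ (size φ) z≤n)

total-<₂ : ∀ {n} (φ ψ : Formula Var) → total (φ ∷ ψ ∷ []) < n → total (ψ ∷ []) < n
total-<₂ φ ψ = ≤-<-trans (m≤n+m _ (size φ))

measure≤total : (Γ Δ : List (Formula Var)) → measure Γ Δ ≤ total (Γ ++ Δ)
measure≤total Γ Δ = ≤-trans (+-monoˡ-≤ (total Δ) (total-□⁻¹ Γ))
                            (≤-reflexive (sym (total-++ Γ Δ)))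

measure-□ : ∀ φ (Γ Δ : List (Formula Var)) → measure (□ φ ∷ Γ) Δ ≤ total (φ ∷ Γ ++ Δ)
measure-□ φ Γ Δ = ≤-trans (≤-reflexive (+-assoc (size φ) (total (□⁻¹ Γ)) (total Δ)))
                          (+-monoʳ-≤ (size φ) (measure≤total Γ Δ))

-- Proof search

Countermodel : List (Formula Var) → List (Formula Var) → Set
Countermodel Γ Δ = ∃[ t ] All (t ⊩_) Γ × All (λ φ → ¬ (t ⊩ φ)) Δ

Decision : List (Formula Var) → List (Formula Var) → Set
Decision Γ Δ = G4KM (Γ ⇒ Δ) ⊎ Countermodel Γ Δ

Decision-↭ : Γ ↭ Γ′ → Δ ↭ Δ′ → Decision Γ Δ → Decision Γ′ Δ′
Decision-↭ π ρ = Sum.map (exchange π ρ)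
  λ { (t , hs , ns) → t , All-resp-↭ π hs , All-resp-↭ ρ ns }

extract : φ ∈ Γ → ∃[ Γ′ ] Γ ↭ φ ∷ Γ′
extract φ∈Γ with Γ₁ , Γ₂ , refl ← ∈-∃++ φ∈Γ = Γ₁ ++ Γ₂ , shift _ Γ₁ Γ₂

-- The condition for attaching `u` as a child of a root labelled `Γ`.
Good : List (Formula Var) → Tree Var → Set
Good Γ u = All (u ⊩_) (□⁻¹ Γ)

-- Q holds of node Γ us whenever all members of us are good and us contains the
-- given successors; such requirements can therefore be met simultaneously.
record Safe (Γ : List (Formula Var)) (Q : Tree Var → Set) : Set where
  constructor safe
  field
    {successors} : List (Tree Var)
    good         : All (Good Γ) successors
    holds        : ∀ {us} → All (Good Γ) us → successors ⊆ us → Q (node Γ us)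

open Safe

Safe-× : {P Q : Tree Var → Set} → Safe Γ P → Safe Γ Q → Safe Γ (λ t → P t × Q t)
Safe-× s s′ = safe (++⁺ (good s) (good s′)) λ g ⊆us →
  holds s  g (⊆us ∘ xs⊆xs++ys (successors s) _) ,
  holds s′ g (⊆us ∘ xs⊆ys++xs _ (successors s))

Safe-All : {Q : Formula Var → Tree Var → Set} →
  All (λ φ → Safe Γ (Q φ)) Δ → Safe Γ (λ t → All (λ φ → Q φ t) Δ)
Safe-All []       = safe [] λ _ _ → []
Safe-All (s ∷ ss) =
  let s′ = Safe-× s (Safe-All ss) in safe (good s′) λ g ⊆us →
    let q , qs = holds s′ g ⊆us in q ∷ qs

module _ {Γ : List (Formula Var)} {us : List (Tree Var)} (good : All (Good Γ) us) where

  above-node : φ ∈ Γ → ∀ u → node Γ us <ᵗ u → u ⊩ unbox φ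
  above-node {φ = φ} φ∈Γ u (c , c∈us , c≤u) =
    ⊩-mono (unbox φ) c≤u (All.lookup (All.lookup good c∈us) (∈-map⁺ unbox φ∈Γ))

  node-var : ∀ {p} → var p ∈ Γ → node Γ us ⊩ var p
  node-var p∈Γ _ ε           n = n p∈Γ
  node-var p∈Γ u (c∈us ◅ c≤u)  = above-node p∈Γ u (_ , c∈us , c≤u) u ε

  -- `□⁻¹` leaves an implication unchanged, so good children force it everywhere above the root; at
  -- the root itself its antecedent fails.
  node-⊃ : φ ⊃ ψ ∈ Γ → ¬ (node Γ us ⊩ φ) → node Γ us ⊩ φ ⊃ ψ
  node-⊃ ⊃∈Γ n _ ε              h = contradiction h n
  node-⊃ ⊃∈Γ n u (c∈us ◅ c≤u) h = above-node ⊃∈Γ u (_ , c∈us , c≤u) u ε h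

choose : {A : Set} {P : Formula Var → Set} (Γ : List (Formula Var)) →
  (∀ {φ} → φ ∈ Γ → A ⊎ P φ) → A ⊎ All P Γ
choose []      f = inj₂ []
choose (φ ∷ Γ) f with f (here refl) | choose Γ (f ∘ there)
... | inj₁ a | _       = inj₁ a
... | inj₂ _ | inj₁ a  = inj₁ a
... | inj₂ p | inj₂ ps = inj₂ (p ∷ ps)

⊩-const : ∀ φ ψ → t ⊩ ψ → t ⊩ φ ⊃ ψ
⊩-const φ ψ h u t≤u _ = ⊩-mono ψ t≤u h

⊩-⊃⊃ : ∀ φ χ ψ → t ⊩ χ ⊃ ψ → t ⊩ φ → t ⊩ (φ ⊃ χ) ⊃ ψ
⊩-⊃⊃ φ χ ψ h k u t≤u f = h u t≤u (f u ε (⊩-mono φ t≤u k))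

module Search {Var : Set} (_≟_ : DecidableEquality Var) where

  var? : ∀ p → (φ : Formula Var) → Dec (var p ≡ φ)
  var? p (var q) = map′ (λ { refl → refl }) (λ { refl → refl }) (p ≟ q)
  var? p ⊥       = no λ ()
  var? p (φ ∧ ψ) = no λ ()
  var? p (φ ∨ ψ) = no λ ()
  var? p (φ ⊃ ψ) = no λ ()
  var? p (□ φ)   = no λ ()

  module Step (Γ Δ : List (Formula Var))
    (decide : (Γ′ Δ′ : List (Formula Var)) → measure Γ′ Δ′ < measure Γ Δ → Decision Γ′ Δ′) where

    -- Here `k` is the weight of the principal formula, `Γ₀`, `Δ₀` are the side formulas of the
    -- conclusion, `Γ₁`, `Δ₁` the formulas a rule introduces and `Γ₂`, `Δ₂` the side formulas it
    -- retains.
    premise : ∀ k (Γ₀ Δ₀ Γ₁ Δ₁ : List (Formula Var)) {Γ₂ Δ₂} →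
      measure Γ Δ ≡ k + measure Γ₀ Δ₀ → measure Γ₁ Δ₁ < k →
      total (□⁻¹ Γ₂) ≤ total (□⁻¹ Γ₀) → total Δ₂ ≤ total Δ₀ →
      Decision (Γ₁ ++ Γ₂) (Δ₁ ++ Δ₂)
    premise k Γ₀ Δ₀ Γ₁ Δ₁ {Γ₂} {Δ₂} eq lt Γ≤ Δ≤ = decide _ _
      (subst₂ _<_ (sym (measure-++ Γ₁ Γ₂ Δ₁ Δ₂)) (sym eq)
        (+-mono-<-≤ lt (+-mono-≤ Γ≤ Δ≤)))

    module Left {φ : Formula Var} {Γ₀ : List (Formula Var)} (π : Γ ↭ φ ∷ Γ₀) where

      measure-≡ : measure Γ Δ ≡ size (unbox φ) + measure Γ₀ Δ
      measure-≡ = trans (cong (_+ total Δ) (total-↭ (map⁺ unbox π)))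
                        (+-assoc (size (unbox φ)) (total (□⁻¹ Γ₀)) (total Δ))

      current : ∀ Γ₁ Δ₁ → total (Γ₁ ++ Δ₁) < size (unbox φ) →
        Decision (Γ₁ ++ Γ₀) (Δ₁ ++ Δ)
      current Γ₁ Δ₁ lt = premise (size (unbox φ)) Γ₀ Δ Γ₁ Δ₁ measure-≡
        (≤-<-trans (measure≤total Γ₁ Δ₁) lt) ≤-refl ≤-refl

      later : ∀ Γ₁ Δ₁ → measure Γ₁ Δ₁ < size (unbox φ) →
        Decision (Γ₁ ++ □⁻¹ Γ₀) (Δ₁ ++ [])
      later Γ₁ Δ₁ lt = premise (size (unbox φ)) Γ₀ Δ Γ₁ Δ₁ measure-≡
        -- Measuring the premise unboxes its left context a second time.
        lt (total-□⁻¹ (□⁻¹ Γ₀)) z≤n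

      conclude : Decision (φ ∷ Γ₀) Δ → Decision Γ Δ
      conclude = Decision-↭ (↭-sym π) ↭-refl

      φ∈Γ : φ ∈ Γ
      φ∈Γ = ∈-resp-↭ (↭-sym π) (here refl)

      good-∷ : {u : Tree Var} → u ⊩ unbox φ → Good Γ₀ u → Good Γ u
      good-∷ h hs = All-resp-↭ (map⁺ unbox (↭-sym π)) (h ∷ hs)

    module Right {φ : Formula Var} {Δ₀ : List (Formula Var)} (π : Δ ↭ φ ∷ Δ₀) where

      measure-≡ : measure Γ Δ ≡ size φ + measure Γ Δ₀
      measure-≡ = trans (cong (total (□⁻¹ Γ) +_) (total-↭ π))
                        (swap₁ (total (□⁻¹ Γ)) (size φ) (total Δ₀))
        where
        swap₁ : ∀ m n o → m + (n + o) ≡ n + (m + o)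
        swap₁ = solve-∀

      current : ∀ Γ₁ Δ₁ → total (Γ₁ ++ Δ₁) < size φ →
        Decision (Γ₁ ++ Γ) (Δ₁ ++ Δ₀)
      current Γ₁ Δ₁ lt = premise (size φ) Γ Δ₀ Γ₁ Δ₁ measure-≡
        (≤-<-trans (measure≤total Γ₁ Δ₁) lt) ≤-refl ≤-refl

      later : ∀ Γ₁ Δ₁ → measure Γ₁ Δ₁ < size φ →
        Decision (Γ₁ ++ □⁻¹ Γ) (Δ₁ ++ [])
      later Γ₁ Δ₁ lt = premise (size φ) Γ Δ₀ Γ₁ Δ₁ measure-≡
        lt (total-□⁻¹ (□⁻¹ Γ)) z≤n

      conclude : Decision Γ (φ ∷ Δ₀) → Decision Γ Δ
      conclude = Decision-↭ ↭-refl (↭-sym π)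

    -- A countermodel to a premise about the current world also refutes the conclusion. If only the
    -- premise about later worlds fails, its countermodel is kept as a successor. Formulas to which
    -- no rule applies impose requirements without successors.
    left : ∀ φ {Γ₀} → Γ ↭ φ ∷ Γ₀ → Decision Γ Δ ⊎ Safe Γ (_⊩ φ)
    left (var p) π = inj₂ (safe [] λ g _ → node-var g (Left.φ∈Γ π))
    left ⊥       π = inj₁ (Left.conclude π (inj₁ ⊥L))
    left (φ ∧ ψ) π = inj₁ (Left.conclude π (Sum.map ∧L
      (λ { (t , h ∷ k ∷ hs , ns) → t , (h , k) ∷ hs , ns })
      (Left.current π (φ ∷ ψ ∷ []) [] (size-∧ φ ψ))))
    left (φ ∨ ψ) π
      with Left.current π (φ ∷ []) [] (total-<₁ φ ψ (size-∨ φ ψ))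
         | Left.current π (ψ ∷ []) [] (total-<₂ φ ψ (size-∨ φ ψ))
    ... | inj₁ d | inj₁ e = inj₁ (Left.conclude π (inj₁ (∨L d e)))
    ... | inj₂ (t , h ∷ hs , ns) | _ =
      inj₁ (Left.conclude π (inj₂ (t , (λ n → proj₁ n h) ∷ hs , ns)))
    ... | inj₁ _ | inj₂ (t , h ∷ hs , ns) =
      inj₁ (Left.conclude π (inj₂ (t , (λ n → proj₂ n h) ∷ hs , ns)))
    left (□ φ) π = inj₂ (safe [] λ g _ → above-node g (Left.φ∈Γ π))
    left (var p ⊃ φ) {Γ₀} π with any? (var? p) Γ₀
    ... | yes p∈Γ₀ = let _ , σ = extract p∈Γ₀ in
      inj₁ (Left.conclude π (Sum.map
        (λ d → exchange (↭-trans (swap _ _ ↭-refl) (prep _ (↭-sym σ))) ↭-refl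
          (p⊃L (exchange (↭-trans (prep _ σ) (swap _ _ ↭-refl)) ↭-refl d)))
        (λ { (t , h ∷ hs , ns) → t , ⊩-const (var p) φ h ∷ hs , ns })
        (Left.current π (φ ∷ []) [] (total-<₂ (var p) φ (size-⊃ (var p) φ)))))
    -- Forcing `var p` at the root would require `var p` in its label `Γ`.
    ... | no p∉Γ₀ = inj₂ (safe [] λ g _ → node-⊃ g (Left.φ∈Γ π) λ h →
      h _ ε λ p∈Γ → case ∈-resp-↭ π p∈Γ of λ { (there p∈Γ₀) → p∉Γ₀ p∈Γ₀ })
    left (⊥ ⊃ φ) π = inj₂ (safe [] λ g _ → node-⊃ g (Left.φ∈Γ π) id)
    left (φ ∧ ψ ⊃ χ) π = inj₁ (Left.conclude π (Sum.map ∧⊃L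
      (λ { (t , h ∷ hs , ns) →
        t , (λ { u t≤u (a , b) → h u t≤u a u ε b }) ∷ hs , ns })
      (Left.current π (φ ⊃ ψ ⊃ χ ∷ []) [] (size-∧⊃ φ ψ χ))))
    left (φ ∨ ψ ⊃ χ) π = inj₁ (Left.conclude π (Sum.map ∨⊃L
      (λ { (t , h ∷ k ∷ hs , ns) →
        t , (λ u t≤u d → ⊩-stable χ λ n → d (n ∘ h u t≤u , n ∘ k u t≤u)) ∷ hs , ns })
      (Left.current π (φ ⊃ χ ∷ ψ ⊃ χ ∷ []) [] (size-∨⊃ φ ψ χ))))
    left (□ φ ⊃ ψ) π
      with Left.current π (ψ ∷ []) [] (total-<₂ (□ φ) ψ (size-⊃ (□ φ) ψ))
         | Left.later π (□ φ ∷ ψ ∷ []) (φ ∷ [])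
             (≤-<-trans (measure-□ φ (ψ ∷ []) (φ ∷ [])) (size-□⊃ φ ψ))
    ... | inj₂ (t , h ∷ hs , ns) | _ =
      inj₁ (Left.conclude π (inj₂ (t , ⊩-const (□ φ) ψ h ∷ hs , ns)))
    ... | inj₁ e | inj₁ d = inj₁ (Left.conclude π (inj₁ (□⊃L d e)))
    -- The tree `c` forces `ψ`, hence the principal implication, which makes it good; as it refutes
    -- `φ`, its parent cannot force `□ φ`.
    ... | inj₁ _ | inj₂ (c , _ ∷ h ∷ hs , n ∷ []) = inj₂
      (safe (Left.good-∷ π (⊩-const (□ φ) ψ h) hs ∷ []) λ g ⊆us →
        node-⊃ g (Left.φ∈Γ π) λ k → n (k c (c , ⊆us (here refl) , ε)))
    left ((φ ⊃ χ) ⊃ ψ) π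
      with Left.current π (χ ⊃ ψ ∷ φ ∷ []) (χ ∷ []) (size-⊃⊃ φ χ ψ)
         | Left.later π (χ ⊃ ψ ∷ φ ∷ []) (χ ∷ [])
             (≤-<-trans (measure≤total (χ ⊃ ψ ∷ φ ∷ []) (χ ∷ [])) (size-⊃⊃ φ χ ψ))
         | Left.current π (ψ ∷ []) [] (total-<₂ (φ ⊃ χ) ψ (size-⊃ (φ ⊃ χ) ψ))
    ... | inj₂ (t , h ∷ k ∷ hs , _ ∷ ns) | _ | _ =
      inj₁ (Left.conclude π (inj₂ (t , ⊩-⊃⊃ φ χ ψ h k ∷ hs , ns)))
    ... | inj₁ _ | _ | inj₂ (t , h ∷ hs , ns) =
      inj₁ (Left.conclude π (inj₂ (t , ⊩-const (φ ⊃ χ) ψ h ∷ hs , ns)))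
    ... | inj₁ d | inj₁ e | inj₁ f = inj₁ (Left.conclude π (inj₁ (⊃⊃L d e f)))
    -- As a child, `c` keeps the root from forcing `φ ⊃ χ`, since it forces `φ` and refutes `χ`.
    ... | inj₁ _ | inj₂ (c , h ∷ k ∷ hs , n ∷ []) | inj₁ _ = inj₂
      (safe (Left.good-∷ π (⊩-⊃⊃ φ χ ψ h k) hs ∷ []) λ g ⊆us →
        node-⊃ g (Left.φ∈Γ π) λ f → n (f c (⊆us (here refl) ◅ ε) k))

    right : ∀ φ {Δ₀} → Δ ↭ φ ∷ Δ₀ → Decision Γ Δ ⊎ Safe Γ (λ t → ¬ (t ⊩ φ))
    right (var p) π with any? (var? p) Γ
    ... | yes p∈Γ = let _ , σ = extract p∈Γ in
      inj₁ (Right.conclude π (inj₁ (exchange (↭-sym σ) ↭-refl IdP)))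
    ... | no p∉Γ = inj₂ (safe [] λ _ _ h → h _ ε p∉Γ)
    right ⊥       π = inj₂ (safe [] λ _ _ → id)
    right (φ ∧ ψ) π
      with Right.current π [] (φ ∷ []) (total-<₁ φ ψ (size-∧ φ ψ))
         | Right.current π [] (ψ ∷ []) (total-<₂ φ ψ (size-∧ φ ψ))
    ... | inj₁ d | inj₁ e = inj₁ (Right.conclude π (inj₁ (∧R d e)))
    ... | inj₂ (t , hs , n ∷ ns) | _ =
      inj₁ (Right.conclude π (inj₂ (t , hs , (n ∘ proj₁) ∷ ns)))
    ... | inj₁ _ | inj₂ (t , hs , n ∷ ns) =
      inj₁ (Right.conclude π (inj₂ (t , hs , (n ∘ proj₂) ∷ ns)))
    right (φ ∨ ψ) π = inj₁ (Right.conclude π (Sum.map ∨R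
      (λ { (t , hs , m ∷ n ∷ ns) → t , hs , (λ d → d (m , n)) ∷ ns })
      (Right.current π [] (φ ∷ ψ ∷ []) (size-∨ φ ψ))))
    right (□ φ) π
      with Right.later π (□ φ ∷ []) (φ ∷ [])
             (≤-<-trans (measure-□ φ [] (φ ∷ [])) (size-□ φ))
    ... | inj₁ d = inj₁ (Right.conclude π (inj₁ (□R d)))
    ... | inj₂ (c , _ ∷ hs , n ∷ []) = inj₂
      (safe (hs ∷ []) λ _ ⊆us h → n (h c (c , ⊆us (here refl) , ε)))
    right (φ ⊃ ψ) π
      with Right.current π (φ ∷ []) (ψ ∷ []) (size-⊃ φ ψ)
         | Right.later π (φ ∷ []) (ψ ∷ [])
             (≤-<-trans (measure≤total (φ ∷ []) (ψ ∷ [])) (size-⊃ φ ψ))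
    ... | inj₂ (t , h ∷ hs , n ∷ ns) | _ =
      inj₁ (Right.conclude π (inj₂ (t , hs , (λ f → n (f t ε h)) ∷ ns)))
    ... | inj₁ d | inj₁ e = inj₁ (Right.conclude π (inj₁ (⊃R d e)))
    ... | inj₁ _ | inj₂ (c , h ∷ hs , n ∷ []) = inj₂
      (safe (hs ∷ []) λ _ ⊆us f → n (f c (⊆us (here refl) ◅ ε) h))

    step : Decision Γ Δ
    step with choose Γ (left _ ∘ proj₂ ∘ extract)
            | choose Δ (right _ ∘ proj₂ ∘ extract)
    ... | inj₁ r | _      = r
    ... | inj₂ _ | inj₁ r = r
    -- No single formula settles the sequent, so one root labelled `Γ`, with all collected
    -- successors as children, meets every requirement at once.
    ... | inj₂ l | inj₂ r =
      let s = Safe-× (Safe-All l) (Safe-All r)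
      in inj₂ (_ , holds s (good s) id)

  decide : ∀ Γ Δ → Acc _<_ (measure Γ Δ) → Decision Γ Δ
  decide Γ Δ (acc rs) = Step.step Γ Δ λ Γ′ Δ′ lt → decide Γ′ Δ′ (rs lt)

theorem1 : (Var : Set) → Var ↔ ℕ → DecidableEquality Var →
    (Γ Δ : List (Formula Var)) (φ : Formula Var) →
    (G4KM (Γ ⇒ Δ) → (_∈ Γ) ⊢KMH ⋁ Δ)
    × ((_∈ Γ) ⊢KMH φ → G4KM (Γ ⇒ φ ∷ []))
theorem1 Var _ _≟_ Γ Δ φ = G4KM-sound , complete
  where
  complete : (_∈ Γ) ⊢KMH φ → G4KM (Γ ⇒ φ ∷ [])
  complete d with Search.decide _≟_ Γ (φ ∷ []) (<-wellFounded _)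
  ... | inj₁ e                 = e
  ... | inj₂ (t , hs , n ∷ []) = contradiction (KMH-sound hs d) n
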